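{- Let $n\in\mathbb{N}$, let $G$ be a subgroup of $\mathrm{Sym}(n)$, and let $S$ be a non-empty subset of $[n]$. Then: (i) The (set-wise) stabilizer of $S$ in $G$ is the set of permutations $\pi\in G$ with critical element $c_S(\pi)=\infty$. (ii) $S$ is lexicographically minimal in its $G$-orbit if and only if $c_S(\pi)\notin\pi(S)$ for all $\pi\in G$. (iii) Let $S^-:=S\setminus\{\max S\}$ and assume that $S^-$ is lexicographically minimal in its $G$-orbit. Then a permutation $\pi\in G$ lex-decreases $S$ (i.e. $\pi(S)\prec S$) if and only if one of the following cases occurs: I. $c_{S^- }(\pi)=\infty$ and $\pi(\max S)<\max S$; II. $c_{S^- }(\pi)\in S^-$ and $\pi(\max S)<c_{S^- }(\pi)$; III. $c_{S^- }(\pi)\in S^-$, $\pi(\max S)=c_{S^- }(\pi)$, and $c_S(\pi)\in\pi(S)$.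
   Context: $[n]=\{1,\dots,n\}$; permutations act on subsets elementwise, $\pi(S)=\{\pi(s):s\in S\}$; the $G$-orbit of $S$ is $\{\pi(S):\pi\in G\}$. The lexicographic order on subsets is: $\emptyset\prec S$ for $S\neq\emptyset$, and for non-empty $S,R$: $S\prec R$ iff $\min S<\min R$, or $\min S=\min R$ and $S\setminus\{\min S\}\prec R\setminus\{\min R\}$. For $S\subseteq[n]$ the critical-element table with respect to $S$ is the map $c_S:G\to[n]\cup\{\infty\}$, $c_S(\pi):=\min\bigl(S\,\triangle\,\pi(S)\bigr)$, where $\triangle$ is symmetric difference and $\min\emptyset:=\infty$; $c_S(\pi)$ is the critical element of $\pi$ with respect to $S$. -}

module Defs where

open import Data.Empty using (⊥)
open import Data.Fin.Base using (Fin; _<_; _≤_)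
open import Data.Fin.Permutation using (Permutation′; _⟨$⟩ʳ_; _≈_; id; flip; _∘ₚ_)
open import Data.Fin.Properties using (_≟_; any?; ≤-totalOrder; ≤-isTotalOrder)
open import Data.Fin.Subset
  using (Subset; Nonempty; _∈_; _∪_; _─_; _-_) renaming (⊥ to ∅)
open import Data.Fin.Subset.Properties using (_∈?_)
import Data.List.Base as List
import Data.List.Extrema as Extrema
open import Data.Nat.Base using (ℕ)
open import Data.Product.Base using (∃; _×_; _,_)
open import Data.Sum.Base using (_⊎_)
open import Data.Vec.Base using (tabulate)
open import Level using (Level; 0ℓ) renaming (suc to lsuc)
open import Relation.Binary.Bundles using (TotalOrder)
import Relation.Binary.Construct.Add.Supremum.NonStrict as NonStrict
import Relation.Binary.Construct.Add.Supremum.Strict as Strict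
open import Relation.Binary.PropositionalEquality.Core using (_≡_)
open import Relation.Nullary.Construct.Add.Supremum using (_⁺; [_]; ⊤⁺)
open import Relation.Nullary.Decidable.Core using (does; _×-dec_)
open import Relation.Nullary.Negation.Core using (¬_)
open import Relation.Unary using (Pred)

private
  variable
    n : ℕ
    ℓ : Level

-- [n] = {1, …, n} is represented by Fin n, the number i + 1 by the index i;
-- only the order of [n] is used.  [n] ∪ {∞} is Fin n ⁺, with ∞ = ⊤⁺.

infix 4 _<∞_ _∈∞_ _∉∞_

_<∞_ : Fin n ⁺ → Fin n ⁺ → Set
_<∞_ = Strict._<⁺_ _<_

_∈∞_ : Fin n ⁺ → Subset n → Set
[ x ] ∈∞ S = x ∈ S
⊤⁺    ∈∞ S = ⊥

_∉∞_ : Fin n ⁺ → Subset n → Set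
x ∉∞ S = ¬ (x ∈∞ S)

∞-totalOrder : ℕ → TotalOrder 0ℓ 0ℓ 0ℓ
∞-totalOrder n = record
  { isTotalOrder = NonStrict.≤⁺-isTotalOrder-≡ (_≤_ {n} {n}) ≤-isTotalOrder }

elements : Subset n → List.List (Fin n)
elements {n} S = List.filter (_∈? S) (List.allFin n)

-- min ∅ = ∞.
min : Subset n → Fin n ⁺
min {n} S = Extrema.min (∞-totalOrder n) ⊤⁺ (List.map [_] (elements S))

-- The library's maximum needs a default value; a member of S serves as one, and
-- the result does not depend on which.
max : (S : Subset n) → Nonempty S → Fin n
max {n} S (s , _) = Extrema.max (≤-totalOrder n) s (elements S)

infixl 5 _△_

_△_ : Subset n → Subset n → Subset n
S △ R = (S ─ R) ∪ (R ─ S)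

-- The defining clauses of the lexicographic order.  An equation min S ≡ [ x ]
-- says that S is non-empty with least element x.
infix 4 _≺_ _≼_

data _≺_ {n : ℕ} : Subset n → Subset n → Set where
  ∅≺   : ∀ {S} → Nonempty S → ∅ ≺ S
  min< : ∀ {S R x y} → min S ≡ [ x ] → min R ≡ [ y ] → x < y → S ≺ R
  min≡ : ∀ {S R x} → min S ≡ [ x ] → min R ≡ [ x ] → (S - x) ≺ (R - x) → S ≺ R

_≼_ : Subset n → Subset n → Set
S ≼ R = S ≺ R ⊎ S ≡ R

-- π ∘ₚ ρ applies π first.  Closure under _≈_ is needed because permutations
-- with equal underlying functions need not be propositionally equal.
record SymSubgroup (n : ℕ) (ℓ : Level) : Set (lsuc ℓ) where
  field
    Member      : Pred (Permutation′ n) ℓ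
    resp-≈      : ∀ {π ρ} → π ≈ ρ → Member π → Member ρ
    id∈         : Member id
    ∘-closed    : ∀ {π ρ} → Member π → Member ρ → Member (π ∘ₚ ρ)
    flip-closed : ∀ {π} → Member π → Member (flip π)

infix 4 _∈ᴳ_

_∈ᴳ_ : Permutation′ n → SymSubgroup n ℓ → Set ℓ
π ∈ᴳ G = SymSubgroup.Member G π

image : Permutation′ n → Subset n → Subset n
image π S = tabulate λ x → does (any? λ s → (s ∈? S) ×-dec (x ≟ π ⟨$⟩ʳ s))

Orbit : SymSubgroup n ℓ → Subset n → Pred (Subset n) ℓ
Orbit G S R = ∃ λ π → π ∈ᴳ G × R ≡ image π S

Stabilizer : SymSubgroup n ℓ → Subset n → Pred (Permutation′ n) ℓ
Stabilizer G S π = π ∈ᴳ G × image π S ≡ S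

LexMinimalInOrbit : SymSubgroup n ℓ → Subset n → Set ℓ
LexMinimalInOrbit G S = ∀ R → Orbit G S R → S ≼ R

critical : Subset n → Permutation′ n → Fin n ⁺
critical S π = min (S △ image π S)

{-# OPTIONS --safe #-}
module Submission where

-- Let x be the least element of S △ R.  When neither set contains the other,
-- S ≺ R holds exactly when x ∈ S: deleting a common minimum from both sets
-- keeps x, until one minimum is x itself.  A permutation preserves
-- cardinality, so a set and its image are either equal or ⊆-incomparable, and
-- image π S ≺ S means precisely that the critical element lies in image π S.
-- For the third part, with m = max S, p = π m and S⁻ minimal in its orbit, let
-- c be the critical element of S⁻.  If c = ∞, passing from image π S to S just
-- replaces p by m.  If c is finite, it lies in S⁻, so c < m; the first
-- difference of image π S and S is then p if p < c and c if c < p, while for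
-- p = c the criterion for image π S ≺ S is used as it stands.

open import Defs
open import Data.Bool.Base using (true; if_then_else_)
open import Data.Bool.Properties using (⇔→≡)
open import Data.Nat.Base as ℕ using (ℕ)
open import Data.Nat.Induction using (<-wellFounded)
import Data.Nat.Properties as ℕ
open import Data.Fin.Base using (Fin; _<_; _≤_)
open import Data.Fin.Permutation using (Permutation′; _⟨$⟩ʳ_; _⟨$⟩ˡ_; inverseˡ)
open import Data.Fin.Properties
  using (_≟_; any?; <-cmp; <-trans; <⇒≢; ≤-refl; ≤-antisym; ≤∧≢⇒<; _≤?_;
         ≤-totalOrder)
open import Data.Fin.Subset
  using (Subset; Nonempty; Empty; _∈_; _∉_; _⊆_; _⊂_; _─_; _-_; ∣_∣; inside; outside)
open import Data.Fin.Subset.Properties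
  using (_∈?_; ∉⊥; ⊆-antisym; ⊆-min; p⊂q⇒∣p∣<∣q∣; x∈p∪q⁻; x∈p∪q⁺; ∪-comm; p─q⊆p; x∈⁅x⁆;
         x∈p∧x∉q⇒x∈p─q; x∈p∧x≢y⇒x∈p-y; x∈p⇒∣p-x∣<∣p∣)
import Data.List.Base as List
import Data.List.Extrema as Extrema
open import Data.List.Membership.Propositional.Properties
  using (∈-filter⁺; ∈-filter⁻; ∈-map⁺; ∈-map⁻; ∈-allFin)
open import Data.List.Membership.Propositional using () renaming (_∈_ to _∈ᴸ_)
open import Data.List.Relation.Unary.All as All using ()
open import Data.Product.Base using (∃; _×_; _,_; proj₁; proj₂)
open import Data.Sum.Base using (_⊎_; inj₁; inj₂; [_,_]′)
import Data.Vec.Base as Vec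
open import Data.Vec.Properties using (lookup∘tabulate; []=⇒lookup; lookup⇒[]=)
open import Algebra.Properties.CommutativeMonoid.Sum ℕ.+-0-commutativeMonoid
  using (sum; sum-permute; sum-cong-≗)
open import Function.Base using (_∘_; id)
open import Function.Bundles using (_⇔_; mk⇔; module Equivalence)
open import Function.Construct.Composition using (_⇔-∘_)
open import Function.Construct.Symmetry using (⇔-sym)
open import Induction.WellFounded using (Acc; acc)
open import Relation.Binary.Bundles using (TotalOrder)
open import Relation.Binary.Construct.Add.Supremum.NonStrict using ([≤]-injective)
import Relation.Binary.Construct.Add.Supremum.Strict as Strict
open import Relation.Binary.Definitions using (tri<; tri≈; tri>)
open import Relation.Binary.PropositionalEquality
  using (_≡_; _≢_; refl; sym; trans; cong; subst; module ≡-Reasoning)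
open import Relation.Nullary.Construct.Add.Supremum using ([_]; ⊤⁺; []-injective)
open import Relation.Nullary.Decidable
  using (Dec; does; yes; no; _×-dec_; ¬?; dec-true; decidable-stable)
open import Relation.Nullary.Negation.Core using (¬_; contradiction)
open import Relation.Unary using (_≐_)

open Equivalence using (to; from)

private
  variable
    n : ℕ
    S R T U V : Subset n
    x y c m p : Fin n

-- Least and greatest elements of a subset.

∈-elements⁺ : x ∈ S → x ∈ᴸ elements S
∈-elements⁺ {S = S} = ∈-filter⁺ (_∈? S) (∈-allFin _)

∈-elements⁻ : x ∈ᴸ elements S → x ∈ S
∈-elements⁻ {n} {S = S} x∈ = proj₂ (∈-filter⁻ (_∈? S) {xs = List.allFin n} x∈)

min-≤ : y ∈ S → TotalOrder._≤_ (∞-totalOrder n) (min S) [ y ]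
min-≤ {n} y∈S = All.lookup (Extrema.min≤xs (∞-totalOrder n) ⊤⁺ _) (∈-map⁺ [_] (∈-elements⁺ y∈S))

min≡[]⁻ : min S ≡ [ x ] → x ∈ S × (∀ {y} → y ∈ S → x ≤ y)
min≡[]⁻ {n} {S} {x} eq = x∈S , λ y∈S →
  [≤]-injective _ (subst (λ z → TotalOrder._≤_ (∞-totalOrder n) z _) eq (min-≤ y∈S))
  where
  x∈S : x ∈ S
  x∈S with Extrema.argmin-sel (∞-totalOrder n) id ⊤⁺ (List.map [_] (elements S))
  -- A minimum over a list is either the default, here ∞ and so not `[ x ]`, or a member of the
  -- list.
  ... | inj₁ min≡⊤ = contradiction (trans (sym eq) min≡⊤) λ ()
  ... | inj₂ min∈  with ∈-map⁻ [_] min∈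
  ...   | z , z∈ , min≡z = subst (_∈ S) ([]-injective (trans (sym min≡z) eq)) (∈-elements⁻ z∈)

min≡⊤⁻ : min S ≡ ⊤⁺ → Empty S
min≡⊤⁻ {n} eq (y , y∈S) with () ← subst (λ z → TotalOrder._≤_ (∞-totalOrder n) z [ y ]) eq (min-≤ y∈S)

min≡[]⁺ : x ∈ S → (∀ {y} → y ∈ S → x ≤ y) → min S ≡ [ x ]
min≡[]⁺ {S = S} x∈S x≤ with min S in eq
... | ⊤⁺    = contradiction (_ , x∈S) (min≡⊤⁻ eq)
... | [ z ] = let z∈S , z≤ = min≡[]⁻ eq in cong [_] (≤-antisym (z≤ x∈S) (x≤ z∈S))

min≡⊤⁺ : Empty S → min S ≡ ⊤⁺
min≡⊤⁺ {S = S} S≡∅ with min S in eq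
... | ⊤⁺    = refl
... | [ z ] = contradiction (z , proj₁ (min≡[]⁻ eq)) S≡∅

max-∈ : (S≠∅ : Nonempty S) → max S S≠∅ ∈ S
max-∈ {n} {S} (s , s∈S) with Extrema.argmax-sel (≤-totalOrder n) id s (elements S)
... | inj₁ max≡s = subst (_∈ S) (sym max≡s) s∈S
... | inj₂ max∈  = ∈-elements⁻ max∈

≤-max : (S≠∅ : Nonempty S) → y ∈ S → y ≤ max S S≠∅
≤-max {n} (s , _) y∈S = All.lookup (Extrema.xs≤max (≤-totalOrder n) s _) (∈-elements⁺ y∈S)

-- Symmetric difference and the first difference of two sets.

x∈p─q⇒x∉q : ∀ (p q : Subset n) → x ∈ p ─ q → x ∉ q
x∈p─q⇒x∉q (_ Vec.∷ p) (outside Vec.∷ q) (Vec.there x∈) (Vec.there x∈q) = x∈p─q⇒x∉q p q x∈ x∈q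
x∈p─q⇒x∉q (_ Vec.∷ p) (inside  Vec.∷ q) (Vec.there x∈) (Vec.there x∈q) = x∈p─q⇒x∉q p q x∈ x∈q

x∉p-x : ∀ (p : Subset n) x → x ∉ p - x
x∉p-x p x x∈ = x∈p─q⇒x∉q p _ x∈ (x∈⁅x⁆ x)

∈-△ : x ∈ S △ R ⇔ ((x ∈ S × x ∉ R) ⊎ (x ∈ R × x ∉ S))
∈-△ {x = x} {S} {R} = mk⇔
  ([ inj₁ ∘ split S R , inj₂ ∘ split R S ]′ ∘ x∈p∪q⁻ (S ─ R) (R ─ S))
  λ { (inj₁ (x∈S , x∉R)) → x∈p∪q⁺ (inj₁ (x∈p∧x∉q⇒x∈p─q x∈S x∉R))
    ; (inj₂ (x∈R , x∉S)) → x∈p∪q⁺ {p = S ─ R} (inj₂ (x∈p∧x∉q⇒x∈p─q x∈R x∉S)) }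
  where
  split : ∀ p q → x ∈ p ─ q → x ∈ p × x ∉ q
  split p q x∈ = p─q⊆p p q x∈ , x∈p─q⇒x∉q p q x∈

△-comm : (S R : Subset n) → S △ R ≡ R △ S
△-comm S R = ∪-comm (S ─ R) (R ─ S)

-- This is `min (S △ R) ≡ [ x ]` with `x ∈ S`, unfolded into memberships so that single elements can
-- be deleted or adjoined without recomputing a minimum.
record Leads (S R : Subset n) (x : Fin n) : Set where
  constructor leads
  field
    member    : x ∈ S
    nonmember : x ∉ R
    agree     : ∀ {y} → y < x → y ∈ S ⇔ y ∈ R

open Leads

Leads⇒min△ : Leads S R x → min (S △ R) ≡ [ x ]
Leads⇒min△ {S = S} {R} {x} l = min≡[]⁺ (from ∈-△ (inj₁ (member l , nonmember l))) x≤
  where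
  x≤ : ∀ {y} → y ∈ S △ R → x ≤ y
  x≤ {y} y∈ with x ≤? y
  ... | yes x≤y = x≤y
  ... | no  x≰y with to ∈-△ y∈ | agree l (ℕ.≰⇒> x≰y)
  ...   | inj₁ (y∈S , y∉R) | S⇔R = contradiction (to S⇔R y∈S) y∉R
  ...   | inj₂ (y∈R , y∉S) | S⇔R = contradiction (from S⇔R y∈R) y∉S

Leads⇒min△ʳ : Leads R S x → min (S △ R) ≡ [ x ]
Leads⇒min△ʳ {R = R} {S} l = trans (cong min (△-comm S R)) (Leads⇒min△ l)

-- Both hypotheses determine the minimum of the same symmetric difference, so `x` and `y` coincide.
Leads-asym : Leads S R x → ¬ Leads R S y
Leads-asym {S = S} {y = y} l l′ =
  nonmember l′ (subst (_∈ S) ([]-injective (trans (sym (Leads⇒min△ l)) (Leads⇒min△ʳ l′))) (member l))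

data Comparison (S R : Subset n) : Set where
  equal   : S ≡ R → Comparison S R
  leadsˡ  : Leads S R x → Comparison S R
  leadsʳ  : Leads R S x → Comparison S R

min△≡⊤⁻ : min (S △ R) ≡ ⊤⁺ → S ≡ R
min△≡⊤⁻ {S = S} {R} eq = ⊆-antisym S⊆R R⊆S
  where
  S⊆R : S ⊆ R
  S⊆R {x} x∈S with x ∈? R
  ... | yes x∈R = x∈R
  ... | no  x∉R = contradiction (x , from ∈-△ (inj₁ (x∈S , x∉R))) (min≡⊤⁻ eq)
  R⊆S : R ⊆ S
  R⊆S {x} x∈R with x ∈? S
  ... | yes x∈S = x∈S
  ... | no  x∉S = contradiction (x , from (∈-△ {S = S}) (inj₂ (x∈R , x∉S))) (min≡⊤⁻ eq)

min△-self : (S : Subset n) → min (S △ S) ≡ ⊤⁺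
min△-self S = min≡⊤⁺ λ (x , x∈) → [ (λ (i , o) → o i) , (λ (i , o) → o i) ]′ (to (∈-△ {S = S}) x∈)

-- A least element of `S △ R` lies in exactly one of the sets, and by minimality they agree below
-- it. This comparison is not yet `≺`: a non-empty set leads `∅`, although `∅` precedes it.
compare : (S R : Subset n) → Comparison S R
compare S R with min (S △ R) in eq
... | ⊤⁺    = equal (min△≡⊤⁻ eq)
... | [ x ] = case (to ∈-△ (proj₁ (min≡[]⁻ eq)))
  where
  below : ∀ {P Q : Subset _} → (∀ {y} → y ∈ P × y ∉ Q → x ≤ y) → ∀ {y} → y < x → y ∈ P → y ∈ Q
  below {Q = Q} x≤ {y} y<x y∈P with y ∈? Q
  ... | yes y∈Q = y∈Q
  ... | no  y∉Q = contradiction (x≤ (y∈P , y∉Q)) (ℕ.<⇒≱ y<x)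
  S⇒R : ∀ {y} → y < x → y ∈ S → y ∈ R
  S⇒R = below λ d → proj₂ (min≡[]⁻ eq) (from ∈-△ (inj₁ d))
  R⇒S : ∀ {y} → y < x → y ∈ R → y ∈ S
  R⇒S = below λ d → proj₂ (min≡[]⁻ eq) (from (∈-△ {S = S}) (inj₂ d))
  case : (x ∈ S × x ∉ R) ⊎ (x ∈ R × x ∉ S) → Comparison S R
  case (inj₁ (x∈S , x∉R)) = leadsˡ (leads x∈S x∉R λ y<x → mk⇔ (S⇒R y<x) (R⇒S y<x))
  case (inj₂ (x∈R , x∉S)) = leadsʳ (leads x∈R x∉S λ y<x → mk⇔ (R⇒S y<x) (S⇒R y<x))

-- Lexicographic order in terms of the first difference.

restrict : (y ∈ S → y ∈ R) → y ∈ S - x → y ∈ R - x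
restrict {S = S} {x = x} f y∈ =
  x∈p∧x≢y⇒x∈p-y (f (p─q⊆p S _ y∈)) λ { refl → x∉p-x S x y∈ }

unrestrict : x ∈ R → (y ∈ S - x → y ∈ R - x) → y ∈ S → y ∈ R
unrestrict {x = x} {R} {y} x∈R f y∈S with y ≟ x
... | yes refl = x∈R
... | no  y≢x  = p─q⊆p R _ (f (x∈p∧x≢y⇒x∈p-y y∈S y≢x))

-- Induction on the derivation: `∅≺` gives a proper inclusion, `min<` a first difference at the
-- minimum of `S`, and putting back a common minimum preserves either alternative.
≺⇒⊂⊎Leads : S ≺ R → S ⊂ R ⊎ ∃ (Leads S R)
≺⇒⊂⊎Leads {R = R} (∅≺ (x , x∈R)) = inj₁ (⊆-min R , x , x∈R , ∉⊥)
≺⇒⊂⊎Leads (min< {x = x} minS minR x<y) =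
  let x∈S , x≤ = min≡[]⁻ minS; _ , y≤ = min≡[]⁻ minR in
  inj₂ (x , leads x∈S (ℕ.<⇒≱ x<y ∘ y≤) λ z<x → mk⇔
    (λ z∈S → contradiction (x≤ z∈S) (ℕ.<⇒≱ z<x))
    (λ z∈R → contradiction (y≤ z∈R) (ℕ.<⇒≱ (<-trans z<x x<y))))
≺⇒⊂⊎Leads {S = S} {R} (min≡ {x = x} minS minR S-x≺R-x) with ≺⇒⊂⊎Leads S-x≺R-x
... | inj₁ (S-x⊆R-x , y , y∈R-x , y∉S-x) =
  inj₁ (unrestrict x∈R S-x⊆R-x , y , p─q⊆p R _ y∈R-x ,
        λ y∈S → y∉S-x (x∈p∧x≢y⇒x∈p-y y∈S λ { refl → x∉p-x R x y∈R-x }))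
  where x∈R = proj₁ (min≡[]⁻ minR)
... | inj₂ (y , l) =
  inj₂ (y , leads (p─q⊆p S _ (member l))
    (λ y∈R → nonmember l (x∈p∧x≢y⇒x∈p-y y∈R λ { refl → x∉p-x S x (member l) }))
    λ z<y → mk⇔ (unrestrict x∈R (to (agree l z<y))) (unrestrict x∈S (from (agree l z<y))))
  where
  x∈S = proj₁ (min≡[]⁻ minS)
  x∈R = proj₁ (min≡[]⁻ minR)

-- Common minima are deleted by recursion on the size of `S`. Both `x` and `y` survive each
-- deletion; `y` keeps `R` from running out first, which would reverse the order.
Leads⇒≺ : Leads S R x → y ∈ R → y ∉ S → S ≺ R
Leads⇒≺ {S = S} = go (<-wellFounded ∣ S ∣)
  where
  go : ∀ {S R : Subset n} {x y} → Acc ℕ._<_ ∣ S ∣ → Leads S R x → y ∈ R → y ∉ S → S ≺ R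
  go {S = S} {R} {x} (acc rs) l y∈R y∉S with min S in minS | min R in minR
  ... | ⊤⁺ | _  = contradiction (_ , member l) (min≡⊤⁻ minS)
  ... | _  | ⊤⁺ = contradiction (_ , y∈R) (min≡⊤⁻ minR)
  ... | [ a ] | [ b ] with min≡[]⁻ minS | min≡[]⁻ minR | <-cmp a b
  ...   | _ | _ | tri< a<b _ _ = min< minS minR a<b
  -- Since `b < a ≤ x`, agreement below `x` would put `b` into `S`, below its minimum.
  ...   | a∈S , a≤ | b∈R , _ | tri> _ _ b<a =
    contradiction (a≤ (from (agree l (ℕ.<-≤-trans b<a (a≤ (member l)))) b∈R)) (ℕ.<⇒≱ b<a)
  ...   | a∈S , _ | a∈R , _ | tri≈ _ refl _ = min≡ minS minR (go (rs (x∈p⇒∣p-x∣<∣p∣ a∈S))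
    (leads (x∈p∧x≢y⇒x∈p-y (member l) λ { refl → nonmember l a∈R }) (nonmember l ∘ p─q⊆p R _)
      λ z<x → mk⇔ (restrict (to (agree l z<x))) (restrict (from (agree l z<x))))
    (x∈p∧x≢y⇒x∈p-y y∈R λ { refl → y∉S a∈S }) (y∉S ∘ p─q⊆p S _))

-- Equal size excludes proper inclusion either way: `S ⊂ R` in one direction, and in the other
-- `R ⊂ S`, which would hold if no `y` in `R` lay outside `S`.
≺⇔Leads : ∣ S ∣ ≡ ∣ R ∣ → S ≺ R ⇔ ∃ (Leads S R)
≺⇔Leads {S = S} {R} ∣S∣≡∣R∣ = mk⇔ ⇒ ⇐
  where
  ⇒ : S ≺ R → ∃ (Leads S R)
  ⇒ S≺R with ≺⇒⊂⊎Leads S≺R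
  ... | inj₁ S⊂R = contradiction ∣S∣≡∣R∣ (ℕ.<⇒≢ (p⊂q⇒∣p∣<∣q∣ S⊂R))
  ... | inj₂ l   = l
  ⇐ : ∃ (Leads S R) → S ≺ R
  ⇐ (x , l) with any? (λ y → (y ∈? R) ×-dec ¬? (y ∈? S))
  ... | yes (y , y∈R , y∉S) = Leads⇒≺ l y∈R y∉S
  ... | no  R∖S≡∅ = contradiction (sym ∣S∣≡∣R∣)
    (ℕ.<⇒≢ (p⊂q⇒∣p∣<∣q∣ (R⊆S , x , member l , nonmember l)))
    where
    R⊆S : R ⊆ S
    R⊆S {y} y∈R = decidable-stable (y ∈? S) λ y∉S → R∖S≡∅ (y , y∈R , y∉S)

Leads⇔min△∈ : ∃ (Leads R S) ⇔ (min (S △ R) ∈∞ R)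
Leads⇔min△∈ {R = R} {S} = mk⇔ (λ (x , l) → subst (_∈∞ R) (sym (Leads⇒min△ʳ l)) (member l)) ⇐
  where
  ⇐ : min (S △ R) ∈∞ R → ∃ (Leads R S)
  ⇐ c∈R with compare S R
  ... | equal refl = contradiction (subst (_∈∞ R) (min△-self R) c∈R) λ ()
  ... | leadsˡ l   = contradiction (subst (_∈∞ R) (Leads⇒min△ l) c∈R) (nonmember l)
  ... | leadsʳ l   = _ , l

≺⇔min△∈ : ∣ R ∣ ≡ ∣ S ∣ → R ≺ S ⇔ (min (S △ R) ∈∞ R)
≺⇔min△∈ ∣R∣≡∣S∣ = Leads⇔min△∈ ⇔-∘ ≺⇔Leads ∣R∣≡∣S∣

-- Images under a permutation.

module _ (π : Permutation′ n) where

  ∈-image : x ∈ image π S ⇔ (∃ λ s → s ∈ S × x ≡ π ⟨$⟩ʳ s)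
  ∈-image {x = x} {S} = mk⇔
    (λ x∈ → from-does preimage? (lookup≡ x∈))
    (λ s → lookup⇒[]= x _ (trans (lookup∘tabulate _ x) (dec-true preimage? s)))
    where
    preimage? = any? (λ s → (s ∈? S) ×-dec (x ≟ π ⟨$⟩ʳ s))
    from-does : ∀ {a} {A : Set a} (A? : Dec A) → does A? ≡ true → A
    from-does (yes p) _ = p
    lookup≡ : x ∈ image π S → does preimage? ≡ true
    lookup≡ x∈ = trans (sym (lookup∘tabulate _ x)) ([]=⇒lookup x∈)

  ∈-image-π : π ⟨$⟩ʳ x ∈ image π S ⇔ x ∈ S
  ∈-image-π {S = S} = mk⇔
    (λ πx∈ → let s , s∈S , πx≡πs = to ∈-image πx∈ in
      subst (_∈ S) (sym (trans (sym (inverseˡ π)) (trans (cong (π ⟨$⟩ˡ_) πx≡πs) (inverseˡ π)))) s∈S)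
    (λ x∈S → from ∈-image (_ , x∈S , refl))

  -- Size is the sum of the indicator function. Reindexing by `π` preserves the sum and turns the
  -- indicator of the image into that of `S`.
  ∣image∣ : (S : Subset n) → ∣ image π S ∣ ≡ ∣ S ∣
  ∣image∣ S = begin
    ∣ image π S ∣                            ≡⟨ ∣∣≡sum (image π S) ⟩
    sum (χ (image π S))                      ≡⟨ sum-permute (χ (image π S)) π ⟩
    sum (λ i → χ (image π S) (π ⟨$⟩ʳ i))     ≡⟨ sum-cong-≗ (λ i → cong (λ b → if b then 1 else 0) (lookup≡ i)) ⟩
    sum (χ S)                                ≡⟨ ∣∣≡sum S ⟨
    ∣ S ∣                                    ∎
    where
    open ≡-Reasoning
    χ : ∀ {k} → Subset k → Fin k → ℕ
    χ R i = if Vec.lookup R i then 1 else 0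
    ∣∣≡sum : ∀ {k} (R : Subset k) → ∣ R ∣ ≡ sum (χ R)
    ∣∣≡sum Vec.[]              = refl
    ∣∣≡sum (inside  Vec.∷ R) = cong ℕ.suc (∣∣≡sum R)
    ∣∣≡sum (outside Vec.∷ R) = ∣∣≡sum R
    lookup≡ : ∀ i → Vec.lookup (image π S) (π ⟨$⟩ʳ i) ≡ Vec.lookup S i
    lookup≡ i = ⇔→≡ (mk⇔ ([]=⇒lookup ∘ to ∈-image-π ∘ lookup⇒[]= _ _)
                         ([]=⇒lookup ∘ from ∈-image-π ∘ lookup⇒[]= _ _))

  image-≺ : image π S ≺ S ⇔ (critical S π ∈∞ image π S)
  image-≺ {S = S} = ≺⇔min△∈ (∣image∣ S)

  critical-∞ : image π S ≡ S ⇔ (critical S π ≡ ⊤⁺)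
  critical-∞ {S = S} = mk⇔
    (λ eq → trans (cong (λ R → min (S △ R)) eq) (min△-self S))
    (sym ∘ min△≡⊤⁻)

-- Minimality in the orbit.

≺-irrefl : ¬ S ≺ S
≺-irrefl S≺S = let _ , l = to (≺⇔Leads refl) S≺S in nonmember l (member l)

-- Minimality should mean that no image precedes `S`. One direction uses that `≺` is irreflexive and
-- asymmetric on sets of equal size, the other that it is total there.
LexMinimal⇔ : ∀ {ℓ} {G : SymSubgroup n ℓ} →
              LexMinimalInOrbit G S ⇔ (∀ π → π ∈ᴳ G → critical S π ∉∞ image π S)
LexMinimal⇔ {S = S} {G = G} = mk⇔ ⇒ ⇐
  where
  ⇒ : LexMinimalInOrbit G S → ∀ π → π ∈ᴳ G → critical S π ∉∞ image π S
  ⇒ S-min π π∈G c∈ with from (image-≺ π) c∈ | S-min (image π S) (π , π∈G , refl)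
  ... | πS≺S | inj₂ S≡πS = ≺-irrefl (subst (_≺ S) (sym S≡πS) πS≺S)
  ... | πS≺S | inj₁ S≺πS = Leads-asym (proj₂ (to (≺⇔Leads (∣image∣ π S)) πS≺S))
                                      (proj₂ (to (≺⇔Leads (sym (∣image∣ π S))) S≺πS))
  ⇐ : (∀ π → π ∈ᴳ G → critical S π ∉∞ image π S) → LexMinimalInOrbit G S
  ⇐ c∉ R (π , π∈G , refl) with compare S R
  ... | equal S≡R = inj₂ S≡R
  ... | leadsˡ l  = inj₁ (from (≺⇔Leads (sym (∣image∣ π S))) (_ , l))
  ... | leadsʳ l  = contradiction (to Leads⇔min△∈ (_ , l)) (c∉ π π∈G)

-- Adjoining one new element to a set.

record Adjoin (T : Subset n) (m : Fin n) (S : Subset n) : Set where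
  constructor adjoin
  field
    fresh : m ∉ T
    ∈-new : ∀ {x} → x ∈ S ⇔ (x ≡ m ⊎ x ∈ T)

open Adjoin

adjoin-≢ : Adjoin T m S → x ≢ m → x ∈ S ⇔ x ∈ T
adjoin-≢ a x≢m = mk⇔ ([ (λ x≡m → contradiction x≡m x≢m) , id ]′ ∘ to (∈-new a))
                     (from (∈-new a) ∘ inj₂)

adjoin-agree : Adjoin T m S → Adjoin U p V → (∀ {y} → y < x → y ∈ T ⇔ y ∈ U) →
               x ≤ m → x ≤ p → y < x → y ∈ S ⇔ y ∈ V
adjoin-agree a b T⇔U x≤m x≤p y<x =
  ⇔-sym (adjoin-≢ b (<⇒≢ (ℕ.<-≤-trans y<x x≤p))) ⇔-∘ (T⇔U y<x ⇔-∘ adjoin-≢ a (<⇒≢ (ℕ.<-≤-trans y<x x≤m)))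

-- The new element `p` comes before `m` and before any disagreement of `U` and `T` below it, so it
-- becomes the first difference.
adjoin-leads-new : Adjoin T m S → Adjoin U p V → (∀ {y} → y < p → y ∈ U ⇔ y ∈ T) →
                   p ∉ T → p < m → Leads V S p
adjoin-leads-new a b U⇔T p∉T p<m =
  leads (from (∈-new b) (inj₁ refl)) (p∉T ∘ to (adjoin-≢ a (<⇒≢ p<m)))
        (adjoin-agree b a U⇔T ≤-refl (ℕ.<⇒≤ p<m))

-- Both new elements lie beyond `c`, so the old first difference persists.
adjoin-leads-old : Adjoin T m S → Adjoin U p V → Leads T U c → c < m → c < p → Leads S V c
adjoin-leads-old a b l c<m c<p =
  leads (from (∈-new a) (inj₂ (member l))) (nonmember l ∘ to (adjoin-≢ b (<⇒≢ c<p)))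
        (adjoin-agree a b (agree l) (ℕ.<⇒≤ c<m) (ℕ.<⇒≤ c<p))

adjoin-unique : Adjoin T m S → Adjoin T m V → V ⊆ S
adjoin-unique a b = from (∈-new a) ∘ to (∈-new b)

adjoin-remove : m ∈ S → Adjoin (S - m) m S
adjoin-remove {m = m} {S} m∈S = adjoin (x∉p-x S m) (mk⇔ ⇒ [ (λ { refl → m∈S }) , p─q⊆p S _ ]′)
  where
  ⇒ : ∀ {x} → x ∈ S → x ≡ m ⊎ x ∈ S - m
  ⇒ {x} x∈S with x ≟ m
  ... | yes x≡m = inj₁ x≡m
  ... | no  x≢m = inj₂ (x∈p∧x≢y⇒x∈p-y x∈S x≢m)

-- Injectivity of `π` keeps the new element fresh. Because `Adjoin` is a relation, it describes `S`
-- and its image alike.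
adjoin-image : (π : Permutation′ n) → Adjoin T m S → Adjoin (image π T) (π ⟨$⟩ʳ m) (image π S)
adjoin-image {T = T} {m} {S} π a = adjoin (fresh a ∘ to (∈-image-π π)) (mk⇔ ⇒ ⇐)
  where
  ⇒ : ∀ {x} → x ∈ image π S → x ≡ π ⟨$⟩ʳ m ⊎ x ∈ image π T
  ⇒ x∈ with to (∈-image π) x∈
  ... | s , s∈S , refl with to (∈-new a) s∈S
  ...   | inj₁ refl = inj₁ refl
  ...   | inj₂ s∈T  = inj₂ (from (∈-image-π π) s∈T)
  ⇐ : ∀ {x} → x ≡ π ⟨$⟩ʳ m ⊎ x ∈ image π T → x ∈ image π S
  ⇐ (inj₁ refl) = from (∈-image-π π) (from (∈-new a) (inj₁ refl))
  ⇐ (inj₂ x∈)   with to (∈-image π) x∈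
  ... | s , s∈T , refl = from (∈-image-π π) (from (∈-new a) (inj₂ s∈T))

adjoin-same : Adjoin T m S → Adjoin T p V → ∃ (Leads V S) ⇔ p < m
adjoin-same {T = T} {m} {S} {p} {V} a b = mk⇔ ⇒ (λ p<m → p , adjoin-leads-new a b T⇔T (fresh b) p<m)
  where
  T⇔T : y < x → y ∈ T ⇔ y ∈ T
  T⇔T _ = mk⇔ id id
  ⇒ : ∃ (Leads V S) → p < m
  ⇒ (_ , l) with <-cmp p m
  ... | tri< p<m _ _  = p<m
  -- For `p ≡ m` both sets are the same; for `m < p` the lead is reversed.
  ... | tri≈ _ refl _ = contradiction (adjoin-unique a b (member l)) (nonmember l)
  ... | tri> _ _ m<p  = contradiction (adjoin-leads-new b a T⇔T (fresh a) m<p) (Leads-asym l)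

-- Cases in which a permutation lex-decreases the set.

DecreasingCase : Subset n → Fin n → Permutation′ n → Set
DecreasingCase S m π =
    (critical S⁻ π ≡ ⊤⁺ × π ⟨$⟩ʳ m < m)
  ⊎ (critical S⁻ π ∈∞ S⁻ × [ π ⟨$⟩ʳ m ] <∞ critical S⁻ π)
  ⊎ (critical S⁻ π ∈∞ S⁻ × [ π ⟨$⟩ʳ m ] ≡ critical S⁻ π × critical S π ∈∞ image π S)
  where S⁻ = S - m

-- The split is on how `S - m` compares with its image; the last hypothesis, which minimality
-- supplies, excludes that the image leads.
decreasing⇔case : (π : Permutation′ n) → m ∈ S → (∀ {y} → y ∈ S → y ≤ m) →
                  critical (S - m) π ∉∞ image π (S - m) → image π S ≺ S ⇔ DecreasingCase S m π
decreasing⇔case {n} {m} {S} π m∈S ≤m c∉ with compare (S - m) (image π (S - m))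
... | leadsʳ l = contradiction (to Leads⇔min△∈ (_ , l)) c∉
... | equal S⁻≡πS⁻ = mk⇔ (λ πS≺S → inj₁ (c≡∞ , to πS≺S⇔πm<m πS≺S)) ⇐
  where
  a = adjoin-remove m∈S
  c≡∞ = to (critical-∞ π) (sym S⁻≡πS⁻)
  πS≺S⇔πm<m : image π S ≺ S ⇔ π ⟨$⟩ʳ m < m
  πS≺S⇔πm<m = adjoin-same a (subst (λ T → Adjoin T _ _) (sym S⁻≡πS⁻) (adjoin-image π a))
           ⇔-∘ ≺⇔Leads (∣image∣ π S)
  ⇐ : DecreasingCase S m π → image π S ≺ S
  ⇐ (inj₁ (_ , πm<m))       = from πS≺S⇔πm<m πm<m
  ⇐ (inj₂ (inj₁ (c∈ , _))) = contradiction (subst (_∈∞ (S - m)) c≡∞ c∈) λ ()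
  ⇐ (inj₂ (inj₂ (c∈ , _))) = contradiction (subst (_∈∞ (S - m)) c≡∞ c∈) λ ()
-- The rewrite puts `[ c ]` for the critical element of `S - m`, so case I becomes an absurd
-- equation.
... | leadsˡ {c} l rewrite Leads⇒min△ l = mk⇔ ⇒ ⇐
  where
  a = adjoin-remove m∈S
  b = adjoin-image π a
  c<m : c < m
  c<m = ≤∧≢⇒< (≤m (p─q⊆p S _ (member l))) λ { refl → fresh a (member l) }
  ⇒ : image π S ≺ S → _
  ⇒ πS≺S with <-cmp (π ⟨$⟩ʳ m) c
  ... | tri< πm<c _ _ = inj₂ (inj₁ (member l , Strict.[ πm<c ]))
  ... | tri≈ _ πm≡c _ = inj₂ (inj₂ (member l , cong [_] πm≡c , to (image-≺ π) πS≺S))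
  ... | tri> _ _ c<πm = contradiction (proj₂ (to (≺⇔Leads (∣image∣ π S)) πS≺S))
                                      (Leads-asym (adjoin-leads-old a b l c<m c<πm))
  ⇐ : _ → image π S ≺ S
  ⇐ (inj₁ (() , _))
  ⇐ (inj₂ (inj₁ (_ , Strict.[ πm<c ]))) = from (≺⇔Leads (∣image∣ π S)) (_ ,
    -- The image of `m` is not in the image of `S - m`; being below `c`, where the two sets agree,
    -- it is not in `S - m` either.
    adjoin-leads-new a b (λ y<πm → ⇔-sym (agree l (<-trans y<πm πm<c)))
      (fresh b ∘ to (agree l πm<c)) (<-trans πm<c c<m))
  ⇐ (inj₂ (inj₂ (_ , _ , c∈πS))) = from (image-≺ π) c∈πS

lemma3 : ∀ {ℓ} (n : ℕ) (G : SymSubgroup n ℓ) (S : Subset n) (S≠∅ : Nonempty S) →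
    (Stabilizer G S ≐ (λ π → π ∈ᴳ G × critical S π ≡ ⊤⁺))
    ×
    (LexMinimalInOrbit G S ⇔ (∀ π → π ∈ᴳ G → critical S π ∉∞ image π S))
    ×
    (let m  = max S S≠∅
         S⁻ = S - m
     in LexMinimalInOrbit G S⁻ →
        ∀ π → π ∈ᴳ G →
        (image π S ≺ S) ⇔
        ( (critical S⁻ π ≡ ⊤⁺ × π ⟨$⟩ʳ m < m)
        ⊎ (critical S⁻ π ∈∞ S⁻ × [ π ⟨$⟩ʳ m ] <∞ critical S⁻ π)
        ⊎ (critical S⁻ π ∈∞ S⁻ × [ π ⟨$⟩ʳ m ] ≡ critical S⁻ π × critical S π ∈∞ image π S)))
lemma3 n G S S≠∅ =
  ( (λ {π} (π∈G , πS≡S) → π∈G , to (critical-∞ π) πS≡S)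
  , (λ {π} (π∈G , c≡∞) → π∈G , from (critical-∞ π) c≡∞) ) ,
  LexMinimal⇔ {G = G} ,
  λ S⁻-min π π∈G → decreasing⇔case π (max-∈ S≠∅) (≤-max S≠∅) (to (LexMinimal⇔ {G = G}) S⁻-min π π∈G)
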